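{- For all rational numbers $m_1,m_2$, define $$\begin{aligned} x_1&=56m_1^2m_2+60m_1m_2^2+12m_2^3+44m_1^2+70m_1m_2+24m_2^2+10m_1+9m_2,\\ x_2&=-24m_1^2m_2+12m_2^3-36m_1^2-40m_1m_2-6m_2^2-10m_1-6m_2,\\ x_3&=56m_1^2m_2+80m_1m_2^2+32m_2^3-16m_1^2+20m_1m_2+24m_2^2+4m_2,\\ x_4&=-64m_1^2m_2-80m_1m_2^2-28m_2^3-16m_1^2-60m_1m_2-36m_2^2-10m_1-11m_2,\\ x_5&=-24m_1^2m_2-60m_1m_2^2-28m_2^3+24m_1^2+10m_1m_2-6m_2^2+10m_1+4m_2,\\ y_1&=-24m_1^2m_2+12m_2^3+24m_1^2+40m_1m_2+24m_2^2+10m_1+9m_2,\\ y_2&=56m_1^2m_2+60m_1m_2^2+12m_2^3-16m_1^2-10m_1m_2-6m_2^2-10m_1-6m_2,\\ y_3&=-64m_1^2m_2-80m_1m_2^2-28m_2^3-16m_1^2-20m_1m_2-6m_2^2+4m_2,\\ y_4&=56m_1^2m_2+80m_1m_2^2+32m_2^3+44m_1^2+60m_1m_2+24m_2^2+10m_1+4m_2,\\ y_5&=-24m_1^2m_2-60m_1m_2^2-28m_2^3-36m_1^2-70m_1m_2-36m_2^2-10m_1-11m_2. \end{aligned}$$ Then $\sum_{i=1}^5x_i=\sum_{i=1}^5y_i=0$ and $$\sum_{i=1}^5x_i^r=\sum_{i=1}^5y_i^r\qquad\text{for } r=1,2,3,4,6.$$ Moreover, as a parametric solution this is nontrivial and nonsymmetric: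 in $\mathbb{Q}[m_1,m_2]$ the multiset $\{y_1,\dots,y_5\}$ is equal neither to the multiset $\{x_1,\dots,x_5\}$ nor to the multiset $\{ -x_1,\dots,-x_5\}$.
   Context: An ideal solution of the Tarry-Escott problem of degree $k$ consists of two distinct multisets $\{x_1,\dots,x_{k+1}\}$, $\{y_1,\dots,y_{k+1}\}$ with $\sum x_i^r=\sum y_i^r$ for $r=1,\dots,k$. For $k=4$, a solution with $\sum x_i=\sum y_i=0$ is symmetric if, after rearrangement, $x_i=-y_i$ for all $i$, and nonsymmetric otherwise. -}

module Defs where

open import Algebra.Bundles using (RawRing)
import Algebra.Definitions.RawSemiring as RawSemiringDefs
open import Data.List.Base using (List; []; _∷_; foldr; map)
open import Data.Nat.Base using (ℕ; zero; suc)
open import Data.Rational.Base using (+-*-rawRing)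
open import Level using (0ℓ)
open import Relation.Binary.Bundles using (Setoid)
open import Relation.Binary.PropositionalEquality using (isEquivalence)
open import Relation.Binary.Structures using (IsEquivalence)

module _ {c ℓ} (R : RawRing c ℓ) where
  open RawRing R
  open RawSemiringDefs rawSemiring using (_^_)

  -- A list a₀ ∷ a₁ ∷ … ∷ [] stands for a₀ + a₁ X + …; trailing zeros are
  -- allowed, so equality of polynomials is equality of all coefficients.
  coeff : List Carrier → ℕ → Carrier
  coeff []      _       = 0#
  coeff (a ∷ _) zero    = a
  coeff (_ ∷ p) (suc n) = coeff p n

  addₚ : List Carrier → List Carrier → List Carrier
  addₚ []      q       = q
  addₚ (a ∷ p) []      = a ∷ p
  addₚ (a ∷ p) (b ∷ q) = (a + b) ∷ addₚ p q

  mulₚ : List Carrier → List Carrier → List Carrier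
  mulₚ []      q = []
  mulₚ (a ∷ p) q = addₚ (map (a *_) q) (0# ∷ mulₚ p q)

  polynomialRing : RawRing c ℓ
  polynomialRing = record
    { Carrier = List Carrier
    ; _≈_     = λ p q → ∀ n → coeff p n ≈ coeff q n
    ; _+_     = addₚ
    ; _*_     = mulₚ
    ; -_      = map -_
    ; 0#      = []
    ; 1#      = 1# ∷ []
    }

  constant : Carrier → RawRing.Carrier polynomialRing
  constant a = a ∷ []

  indeterminate : RawRing.Carrier polynomialRing
  indeterminate = 0# ∷ 1# ∷ []

  polynomial-isEquivalence : IsEquivalence _≈_ →
                             IsEquivalence (RawRing._≈_ polynomialRing)
  polynomial-isEquivalence eq = record
    { refl  = λ _ → refl
    ; sym   = λ p≈q n → sym (p≈q n)
    ; trans = λ p≈q q≈r n → trans (p≈q n) (q≈r n)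
    }
    where open IsEquivalence eq

  sum : List Carrier → Carrier
  sum = foldr _+_ 0#

  powerSum : ℕ → List Carrier → Carrier
  powerSum r zs = sum (map (_^ r) zs)

-- ℚ[m₁,m₂] is taken to be ℚ[m₁][m₂].
ℚ[m₁] ℚ[m₁,m₂] : RawRing 0ℓ 0ℓ
ℚ[m₁]    = polynomialRing +-*-rawRing
ℚ[m₁,m₂] = polynomialRing ℚ[m₁]

M₁ M₂ : RawRing.Carrier ℚ[m₁,m₂]
M₁ = constant ℚ[m₁] (indeterminate +-*-rawRing)
M₂ = indeterminate ℚ[m₁]

ℚ[m₁,m₂]-setoid : Setoid 0ℓ 0ℓ
ℚ[m₁,m₂]-setoid = record
  { isEquivalence = polynomial-isEquivalence ℚ[m₁]
      (polynomial-isEquivalence +-*-rawRing isEquivalence) }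

-- The formulas are given over an arbitrary ring so that they can be read both
-- as rational numbers and as elements of ℚ[m₁,m₂].
module _ {c ℓ} (R : RawRing c ℓ) where
  open RawRing R
  open RawSemiringDefs rawSemiring using (_^_; _×_)

  private
    infixl 6 _-_
    _-_ : Carrier → Carrier → Carrier
    a - b = a + (- b)

    ι : ℕ → Carrier
    ι n = n × 1#  -- n as an element of R

  xs : Carrier → Carrier → List Carrier
  xs m₁ m₂ = x₁ ∷ x₂ ∷ x₃ ∷ x₄ ∷ x₅ ∷ []
    where
    x₁ x₂ x₃ x₄ x₅ : Carrier
    x₁ = ι 56 * m₁ ^ 2 * m₂ + ι 60 * m₁ * m₂ ^ 2 + ι 12 * m₂ ^ 3 + ι 44 * m₁ ^ 2
       + ι 70 * m₁ * m₂ + ι 24 * m₂ ^ 2 + ι 10 * m₁ + ι 9 * m₂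
    x₂ = - ι 24 * m₁ ^ 2 * m₂ + ι 12 * m₂ ^ 3 - ι 36 * m₁ ^ 2 - ι 40 * m₁ * m₂
       - ι 6 * m₂ ^ 2 - ι 10 * m₁ - ι 6 * m₂
    x₃ = ι 56 * m₁ ^ 2 * m₂ + ι 80 * m₁ * m₂ ^ 2 + ι 32 * m₂ ^ 3 - ι 16 * m₁ ^ 2
       + ι 20 * m₁ * m₂ + ι 24 * m₂ ^ 2 + ι 4 * m₂
    x₄ = - ι 64 * m₁ ^ 2 * m₂ - ι 80 * m₁ * m₂ ^ 2 - ι 28 * m₂ ^ 3 - ι 16 * m₁ ^ 2
       - ι 60 * m₁ * m₂ - ι 36 * m₂ ^ 2 - ι 10 * m₁ - ι 11 * m₂
    x₅ = - ι 24 * m₁ ^ 2 * m₂ - ι 60 * m₁ * m₂ ^ 2 - ι 28 * m₂ ^ 3 + ι 24 * m₁ ^ 2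
       + ι 10 * m₁ * m₂ - ι 6 * m₂ ^ 2 + ι 10 * m₁ + ι 4 * m₂

  ys : Carrier → Carrier → List Carrier
  ys m₁ m₂ = y₁ ∷ y₂ ∷ y₃ ∷ y₄ ∷ y₅ ∷ []
    where
    y₁ y₂ y₃ y₄ y₅ : Carrier
    y₁ = - ι 24 * m₁ ^ 2 * m₂ + ι 12 * m₂ ^ 3 + ι 24 * m₁ ^ 2 + ι 40 * m₁ * m₂
       + ι 24 * m₂ ^ 2 + ι 10 * m₁ + ι 9 * m₂
    y₂ = ι 56 * m₁ ^ 2 * m₂ + ι 60 * m₁ * m₂ ^ 2 + ι 12 * m₂ ^ 3 - ι 16 * m₁ ^ 2
       - ι 10 * m₁ * m₂ - ι 6 * m₂ ^ 2 - ι 10 * m₁ - ι 6 * m₂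
    y₃ = - ι 64 * m₁ ^ 2 * m₂ - ι 80 * m₁ * m₂ ^ 2 - ι 28 * m₂ ^ 3 - ι 16 * m₁ ^ 2
       - ι 20 * m₁ * m₂ - ι 6 * m₂ ^ 2 + ι 4 * m₂
    y₄ = ι 56 * m₁ ^ 2 * m₂ + ι 80 * m₁ * m₂ ^ 2 + ι 32 * m₂ ^ 3 + ι 44 * m₁ ^ 2
       + ι 60 * m₁ * m₂ + ι 24 * m₂ ^ 2 + ι 10 * m₁ + ι 4 * m₂
    y₅ = - ι 24 * m₁ ^ 2 * m₂ - ι 60 * m₁ * m₂ ^ 2 - ι 28 * m₂ ^ 3 - ι 36 * m₁ ^ 2
       - ι 70 * m₁ * m₂ - ι 36 * m₂ ^ 2 - ι 10 * m₁ - ι 11 * m₂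

{-# OPTIONS --safe #-}
-- Both multisets are polynomial in m₁ and m₂, so each equality of power sums is
-- the image, under evaluation at rational numbers, of an identity in ℚ[m₁,m₂]
-- between two explicit polynomials. A permutation would preserve the set of
-- values of any given coefficient: y₁ has m₁m₂-coefficient 40, which no xᵢ has,
-- and m₁²-coefficient 24, which no −xᵢ has.
module Submission where

open import Defs
open import Algebra.Bundles using (CommutativeRing; RawRing)
import Algebra.Definitions.RawSemiring as RawSemiringDefs
import Algebra.Morphism.Construct.Identity as Identity
open import Algebra.Morphism.Structures using (IsRingHomomorphism)
import Algebra.Properties.CommutativeSemigroup as CommutativeSemigroupProperties
import Algebra.Properties.Ring as RingProperties
open import Data.Integer.Base using (+_)
open import Data.List.Base using (List; []; _∷_; map)
open import Data.List.Membership.Propositional using (_∈_)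
open import Data.List.Properties using (≡-dec)
open import Data.List.Relation.Binary.Permutation.Setoid ℚ[m₁,m₂]-setoid using (_↭_; ↭-sym)
open import Data.List.Relation.Binary.Permutation.Setoid.Properties ℚ[m₁,m₂]-setoid using (All-resp-↭)
open import Data.List.Relation.Binary.Pointwise using (Pointwise; []; _∷_)
open import Data.List.Relation.Unary.All as All using (All; []; _∷_; all?)
open import Data.Nat.Base using (ℕ; zero; suc)
open import Data.Product using (Σ; _×_; _,_; proj₁; proj₂)
open import Data.Rational.Base using (ℚ; 0ℚ; +-*-rawRing; _/_)
open import Data.Rational.Properties using (_≟_; +-*-commutativeRing)
open import Relation.Binary.Definitions using (DecidableEquality)
open import Relation.Binary.PropositionalEquality as ≡ using (_≡_; _≢_)
import Relation.Binary.Reasoning.Setoid as SetoidReasoning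
open import Relation.Nullary using (¬_; Dec)
open import Relation.Nullary.Decidable using (from-yes; ¬?)

module _ {c ℓ} (R : RawRing c ℓ) where
  open RawRing R

  -- Holds over any raw ring so that it can serve for both layers of `ℚ[m₁,m₂]`. A raw ring has no
  -- laws, so reflexivity at `0#`, needed past the end of the list, is assumed.
  coeff-zero : ∀ {p} → All (_≈ 0#) p → 0# ≈ 0# → ∀ n → coeff R p n ≈ 0#
  coeff-zero []            0≈0 _       = 0≈0
  coeff-zero (a≈0 ∷ _)     _   zero    = a≈0
  coeff-zero (_   ∷ p≈0)   0≈0 (suc n) = coeff-zero p≈0 0≈0 n

-- Compatibility of the formulas with ring homomorphisms.

module Homomorphism
  {c₁ ℓ₁ c₂ ℓ₂} (R : RawRing c₁ ℓ₁) (S : CommutativeRing c₂ ℓ₂)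
  {⟦_⟧ : RawRing.Carrier R → CommutativeRing.Carrier S}
  (isHom : IsRingHomomorphism R (CommutativeRing.rawRing S) ⟦_⟧) where

  private
    module R = RawRing R
    module S = CommutativeRing S
    module R^ = RawSemiringDefs R.rawSemiring
    module S^ = RawSemiringDefs (RawRing.rawSemiring S.rawRing)
  open IsRingHomomorphism isHom

  infix 4 _∼_
  _∼_ : R.Carrier → S.Carrier → Set ℓ₂
  a ∼ b = ⟦ a ⟧ S.≈ b

  +-∼ : ∀ {a b a′ b′} → a ∼ a′ → b ∼ b′ → a R.+ b ∼ a′ S.+ b′
  +-∼ p q = S.trans (+-homo _ _) (S.+-cong p q)

  *-∼ : ∀ {a b a′ b′} → a ∼ a′ → b ∼ b′ → a R.* b ∼ a′ S.* b′
  *-∼ p q = S.trans (*-homo _ _) (S.*-cong p q)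

  ^-∼ : ∀ {a a′} → a ∼ a′ → ∀ n → a R^.^ n ∼ a′ S^.^ n
  ^-∼ p zero    = 1#-homo
  ^-∼ p (suc n) = *-∼ p (^-∼ p n)

  sum-∼ : ∀ {as bs} → Pointwise _∼_ as bs → sum R as ∼ sum S.rawRing bs
  sum-∼ []       = 0#-homo
  sum-∼ (p ∷ ps) = +-∼ p (sum-∼ ps)

  powerSum-∼ : ∀ r {as bs} → Pointwise _∼_ as bs →
               powerSum R r as ∼ powerSum S.rawRing r bs
  powerSum-∼ r []       = 0#-homo
  powerSum-∼ r (p ∷ ps) = +-∼ (^-∼ p r) (powerSum-∼ r ps)

  -- The subring {(a , ⟦ a ⟧)} of R × S. A formula stated for all rings can be
  -- read in it, and is thereby seen to commute with ⟦_⟧.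
  graph : RawRing _ _
  graph = record
    { Carrier = Σ R.Carrier λ a → Σ S.Carrier λ b → a ∼ b
    ; _≈_     = λ x y → proj₁ x R.≈ proj₁ y
    ; _+_     = λ (a , b , p) (a′ , b′ , p′) → a R.+ a′ , b S.+ b′ , +-∼ p p′
    ; _*_     = λ (a , b , p) (a′ , b′ , p′) → a R.* a′ , b S.* b′ , *-∼ p p′
    ; -_      = λ (a , b , p) → R.- a , S.- b , S.trans (-‿homo a) (S.-‿cong p)
    ; 0#      = R.0# , S.0# , 0#-homo
    ; 1#      = R.1# , S.1# , 1#-homo
    }

  graph-∼ : (zs : List (RawRing.Carrier graph)) →
            Pointwise _∼_ (map proj₁ zs) (map (λ z → proj₁ (proj₂ z)) zs)
  graph-∼ []       = []
  graph-∼ (z ∷ zs) = proj₂ (proj₂ z) ∷ graph-∼ zs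

  module _ m₁ m₂ {m₁′ m₂′} (p₁ : m₁ ∼ m₁′) (p₂ : m₂ ∼ m₂′) where

    xs-∼ : Pointwise _∼_ (xs R m₁ m₂) (xs S.rawRing m₁′ m₂′)
    -- The projections of `xs graph` reduce to `xs` over `R` and over `S`: the exponents and integer
    -- coefficients are literals, so everything unfolds.
    xs-∼ = graph-∼ (xs graph (m₁ , m₁′ , p₁) (m₂ , m₂′ , p₂))

    ys-∼ : Pointwise _∼_ (ys R m₁ m₂) (ys S.rawRing m₁′ m₂′)
    ys-∼ = graph-∼ (ys graph (m₁ , m₁′ , p₁) (m₂ , m₂′ , p₂))

-- Evaluation of polynomials at `s`, extending a homomorphism `φ` on coefficients.

module Evaluation
  {c₁ ℓ₁ c₂ ℓ₂} (R : RawRing c₁ ℓ₁) (S : CommutativeRing c₂ ℓ₂)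
  {φ : RawRing.Carrier R → CommutativeRing.Carrier S}
  (isHom : IsRingHomomorphism R (CommutativeRing.rawRing S) φ)
  (s : CommutativeRing.Carrier S) where

  private
    module R = RawRing R
    module P = RawRing (polynomialRing R)
    module φ = IsRingHomomorphism isHom
  open CommutativeRing S hiding (zero)
  open RingProperties ring using (-0#≈0#; -‿distribʳ-*; -‿+-comm)
  open CommutativeSemigroupProperties using (interchange; x∙yz≈y∙xz)
  open SetoidReasoning setoid

  eval : P.Carrier → Carrier
  eval []      = 0#
  eval (a ∷ p) = φ a + s * eval p

  -- This makes evaluation blind to trailing zeros. The coefficients are compared after applying
  -- `φ`, here and in `eval-cong`, because equality in the raw ring `R` need not be symmetric or
  -- transitive, whereas equality in `S` is.
  eval-zero : ∀ p → (∀ n → φ (coeff R p n) ≈ φ R.0#) → eval p ≈ 0#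
  eval-zero []      _   = refl
  eval-zero (a ∷ p) p≈0 = begin
    φ a + s * eval p  ≈⟨ +-cong (trans (p≈0 zero) φ.0#-homo)
                                (*-congˡ (eval-zero p (λ n → p≈0 (suc n)))) ⟩
    0# + s * 0#       ≈⟨ +-identityˡ _ ⟩
    s * 0#            ≈⟨ zeroʳ s ⟩
    0#                ∎

  eval-cong : ∀ p q → (∀ n → φ (coeff R p n) ≈ φ (coeff R q n)) → eval p ≈ eval q
  eval-cong []      q       p≈q = sym (eval-zero q (λ n → sym (p≈q n)))
  eval-cong (a ∷ p) []      p≈q = eval-zero (a ∷ p) p≈q
  eval-cong (a ∷ p) (b ∷ q) p≈q =
    +-cong (p≈q zero) (*-congˡ (eval-cong p q (λ n → p≈q (suc n))))

  eval-+ : ∀ p q → eval (p P.+ q) ≈ eval p + eval q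
  eval-+ []      q       = sym (+-identityˡ _)
  eval-+ (a ∷ p) []      = sym (+-identityʳ _)
  eval-+ (a ∷ p) (b ∷ q) = begin
    φ (a R.+ b) + s * eval (p P.+ q)
      ≈⟨ +-cong (φ.+-homo a b) (*-congˡ (eval-+ p q)) ⟩
    (φ a + φ b) + s * (eval p + eval q)
      ≈⟨ +-congˡ (distribˡ s _ _) ⟩
    (φ a + φ b) + (s * eval p + s * eval q)
      ≈⟨ interchange +-commutativeSemigroup _ _ _ _ ⟩
    (φ a + s * eval p) + (φ b + s * eval q)  ∎

  -- Commutativity of multiplication in `S` enters here: `s` has to move past `φ a`.
  eval-scale : ∀ a p → eval (map (a R.*_) p) ≈ φ a * eval p
  eval-scale a []      = sym (zeroʳ _)
  eval-scale a (b ∷ p) = begin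
    φ (a R.* b) + s * eval (map (a R.*_) p)
      ≈⟨ +-cong (φ.*-homo a b) (*-congˡ (eval-scale a p)) ⟩
    φ a * φ b + s * (φ a * eval p)
      ≈⟨ +-congˡ (x∙yz≈y∙xz *-commutativeSemigroup s (φ a) (eval p)) ⟩
    φ a * φ b + φ a * (s * eval p)
      ≈⟨ distribˡ (φ a) _ _ ⟨
    φ a * (φ b + s * eval p)  ∎

  eval-* : ∀ p q → eval (p P.* q) ≈ eval p * eval q
  eval-* []      q = sym (zeroˡ _)
  eval-* (a ∷ p) q = begin
    eval (map (a R.*_) q P.+ (R.0# ∷ p P.* q))
      ≈⟨ eval-+ (map (a R.*_) q) _ ⟩
    eval (map (a R.*_) q) + (φ R.0# + s * eval (p P.* q))
      ≈⟨ +-cong (eval-scale a q) (+-cong φ.0#-homo (*-congˡ (eval-* p q))) ⟩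
    φ a * eval q + (0# + s * (eval p * eval q))
      ≈⟨ +-congˡ (+-identityˡ _) ⟩
    φ a * eval q + s * (eval p * eval q)
      ≈⟨ +-congˡ (*-assoc s _ _) ⟨
    φ a * eval q + (s * eval p) * eval q
      ≈⟨ distribʳ (eval q) _ _ ⟨
    (φ a + s * eval p) * eval q  ∎

  eval-‿- : ∀ p → eval (P.- p) ≈ - eval p
  eval-‿- []      = sym -0#≈0#
  eval-‿- (a ∷ p) = begin
    φ (R.- a) + s * eval (P.- p)  ≈⟨ +-cong (φ.-‿homo a) (*-congˡ (eval-‿- p)) ⟩
    - φ a + s * - eval p          ≈⟨ +-congˡ (-‿distribʳ-* s _) ⟨
    - φ a + - (s * eval p)        ≈⟨ -‿+-comm _ _ ⟩
    - (φ a + s * eval p)          ∎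

  eval-constant : ∀ a → eval (constant R a) ≈ φ a
  eval-constant a = trans (+-congˡ (zeroʳ s)) (+-identityʳ (φ a))

  eval-indeterminate : eval (indeterminate R) ≈ s
  eval-indeterminate = begin
    φ R.0# + s * eval P.1#  ≈⟨ +-cong φ.0#-homo (*-congˡ (eval-constant R.1#)) ⟩
    0# + s * φ R.1#         ≈⟨ +-identityˡ _ ⟩
    s * φ R.1#              ≈⟨ *-congˡ φ.1#-homo ⟩
    s * 1#                  ≈⟨ *-identityʳ s ⟩
    s                       ∎

  eval-isRingHomomorphism : IsRingHomomorphism (polynomialRing R) rawRing eval
  eval-isRingHomomorphism = record
    { isSemiringHomomorphism = record
      { isNearSemiringHomomorphism = record
        { +-isMonoidHomomorphism = record
          { isMagmaHomomorphism = record
            { isRelHomomorphism = record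
              { cong = λ {p} {q} p≈q → eval-cong p q (λ n → φ.⟦⟧-cong (p≈q n)) }
            ; homo = eval-+
            }
          ; ε-homo = refl
          }
        ; *-homo = eval-*
        }
      ; 1#-homo = trans (eval-constant R.1#) φ.1#-homo
      }
    ; -‿homo = eval-‿-
    }

-- The identities in ℚ[m₁,m₂], by computation.

X Y : List (RawRing.Carrier ℚ[m₁,m₂])
X = xs ℚ[m₁,m₂] M₁ M₂
Y = ys ℚ[m₁,m₂] M₁ M₂

_≟ₚ_ : DecidableEquality (RawRing.Carrier ℚ[m₁,m₂])
_≟ₚ_ = ≡-dec (≡-dec _≟_)

-- The type checker expands both sides. They agree as lists of coefficient lists, trailing zeros
-- included, so propositional equality can be decided and later transported by plain congruence.
powerSum-X≡Y : All (λ r → powerSum ℚ[m₁,m₂] r X ≡ powerSum ℚ[m₁,m₂] r Y)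
                   (1 ∷ 2 ∷ 3 ∷ 4 ∷ 6 ∷ [])
powerSum-X≡Y =
  from-yes (all? (λ r → powerSum ℚ[m₁,m₂] r X ≟ₚ powerSum ℚ[m₁,m₂] r Y)
    (1 ∷ 2 ∷ 3 ∷ 4 ∷ 6 ∷ []))

AllZero : RawRing.Carrier ℚ[m₁,m₂] → Set
AllZero = All (All (_≡ 0ℚ))

allZero? : ∀ p → Dec (AllZero p)
allZero? = all? (all? (_≟ 0ℚ))

allZero⇒≈0 : ∀ p → AllZero p → RawRing._≈_ ℚ[m₁,m₂] p []
allZero⇒≈0 _ z = coeff-zero ℚ[m₁] (All.map (λ w → coeff-zero +-*-rawRing w ≡.refl) z) (λ _ → ≡.refl)

-- Addition never trims a list, so cancellation leaves zero coefficients instead of `[]`. The sum is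
-- therefore equal to `[]` only coefficientwise, which is checked through `AllZero`.
sum-X≈0 : RawRing._≈_ ℚ[m₁,m₂] (sum ℚ[m₁,m₂] X) []
sum-X≈0 = allZero⇒≈0 (sum ℚ[m₁,m₂] X) (from-yes (allZero? (sum ℚ[m₁,m₂] X)))

sum-Y≈0 : RawRing._≈_ ℚ[m₁,m₂] (sum ℚ[m₁,m₂] Y) []
sum-Y≈0 = allZero⇒≈0 (sum ℚ[m₁,m₂] Y) (from-yes (allZero? (sum ℚ[m₁,m₂] Y)))

-- Specialisation to rational parameters.

module _ (m₁ m₂ : ℚ) where

  private
    -- Evaluation goes in two stages: `E₁` fixes ℚ and sends the inner indeterminate to `m₁`; `E₂`
    -- applies `E₁` to the coefficients and sends the outer indeterminate to `m₂`.
    module E₁ = Evaluation +-*-rawRing +-*-commutativeRing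
                  (Identity.isRingHomomorphism +-*-rawRing ≡.refl) m₁
    module E₂ = Evaluation ℚ[m₁] +-*-commutativeRing E₁.eval-isRingHomomorphism m₂
    module H = Homomorphism ℚ[m₁,m₂] +-*-commutativeRing E₂.eval-isRingHomomorphism

  open IsRingHomomorphism E₂.eval-isRingHomomorphism using (⟦⟧-cong)

  evalM₁ : E₂.eval M₁ ≡ m₁
  evalM₁ = ≡.trans (E₂.eval-constant (indeterminate +-*-rawRing)) E₁.eval-indeterminate

  X∼xs : Pointwise H._∼_ X (xs +-*-rawRing m₁ m₂)
  X∼xs = H.xs-∼ M₁ M₂ evalM₁ E₂.eval-indeterminate

  Y∼ys : Pointwise H._∼_ Y (ys +-*-rawRing m₁ m₂)
  Y∼ys = H.ys-∼ M₁ M₂ evalM₁ E₂.eval-indeterminate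

  sum-xs≡0 : sum +-*-rawRing (xs +-*-rawRing m₁ m₂) ≡ 0ℚ
  sum-xs≡0 = ≡.trans (≡.sym (H.sum-∼ X∼xs))
    (⟦⟧-cong {sum ℚ[m₁,m₂] X} {[]} sum-X≈0)

  sum-ys≡0 : sum +-*-rawRing (ys +-*-rawRing m₁ m₂) ≡ 0ℚ
  sum-ys≡0 = ≡.trans (≡.sym (H.sum-∼ Y∼ys))
    (⟦⟧-cong {sum ℚ[m₁,m₂] Y} {[]} sum-Y≈0)

  powerSum-xs≡ys : ∀ {r} → r ∈ 1 ∷ 2 ∷ 3 ∷ 4 ∷ 6 ∷ [] →
    powerSum +-*-rawRing r (xs +-*-rawRing m₁ m₂)
      ≡ powerSum +-*-rawRing r (ys +-*-rawRing m₁ m₂)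
  powerSum-xs≡ys {r} r∈ = ≡.trans (≡.sym (H.powerSum-∼ r X∼xs))
    (≡.trans (≡.cong E₂.eval (All.lookup powerSum-X≡Y r∈)) (H.powerSum-∼ r Y∼ys))

-- Nontriviality and nonsymmetry.

-- The coefficient of m₁ⁱ m₂ʲ.
coeff₂ : RawRing.Carrier ℚ[m₁,m₂] → ℕ → ℕ → ℚ
coeff₂ p i j = coeff +-*-rawRing (coeff ℚ[m₁] p j) i

-- Permutation is taken up to equality of polynomials, which preserves each coefficient. Avoiding
-- the value `a` thus passes from `qs` to every member of `p ∷ ps`, and the head `p` contradicts it.
absent-coeff⇒¬↭ : ∀ i j a {p ps qs} → coeff₂ p i j ≡ a →
                  All (λ q → coeff₂ q i j ≢ a) qs → ¬ (p ∷ ps ↭ qs)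
absent-coeff⇒¬↭ i j a p≡a qs≢a p∷ps↭qs
  -- The outer polynomial variable is m₂, so its exponent `j` is the first index.
  with All-resp-↭ (λ q≈q′ q≢a q′≡a → q≢a (≡.trans (q≈q′ j i) q′≡a)) (↭-sym p∷ps↭qs) qs≢a
... | p≢a ∷ _ = p≢a p≡a

mainTheorem1 : ((m₁ m₂ : ℚ) →
    sum +-*-rawRing (xs +-*-rawRing m₁ m₂) ≡ 0ℚ
    × sum +-*-rawRing (ys +-*-rawRing m₁ m₂) ≡ 0ℚ
    × ((r : ℕ) → r ∈ 1 ∷ 2 ∷ 3 ∷ 4 ∷ 6 ∷ [] →
    powerSum +-*-rawRing r (xs +-*-rawRing m₁ m₂)
    ≡ powerSum +-*-rawRing r (ys +-*-rawRing m₁ m₂)))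
    × ¬ (ys ℚ[m₁,m₂] M₁ M₂ ↭ xs ℚ[m₁,m₂] M₁ M₂)
    × ¬ (ys ℚ[m₁,m₂] M₁ M₂ ↭ map (RawRing.-_ ℚ[m₁,m₂]) (xs ℚ[m₁,m₂] M₁ M₂))
mainTheorem1 =
    (λ m₁ m₂ → sum-xs≡0 m₁ m₂ , sum-ys≡0 m₁ m₂ , λ r → powerSum-xs≡ys m₁ m₂)
  -- The head `p` is y₁; `≡.refl` computes its coefficient.
  , absent-coeff⇒¬↭ 1 1 (+ 40 / 1) ≡.refl
      (from-yes (all? (λ q → ¬? (coeff₂ q 1 1 ≟ + 40 / 1)) X))
  , absent-coeff⇒¬↭ 2 0 (+ 24 / 1) ≡.refl
      (from-yes (all? (λ q → ¬? (coeff₂ q 2 0 ≟ + 24 / 1)) (map (RawRing.-_ ℚ[m₁,m₂]) X)))
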